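{- We have $E_{Q_5,\mathbf 1}=9$.
   Context: $\mathbb Z_5=\mathbb Z/5\mathbb Z$ and $Q_5=\{1,-1\}$ is the set of non-zero squares in $\mathbb Z_5$. A sequence of length $k$ in $\mathbb Z_5$ is an element of $\mathbb Z_5^k$. A sequence $(x_1,\ldots,x_k)$ in $\mathbb Z_5$ is called a $(Q_5,\mathbf 1)$-weighted zero-sum sequence if there exist $a_1,\ldots,a_k\in Q_5$ such that $a_1x_1+\cdots+a_kx_k=0$ and $a_1+\cdots+a_k=0$ in $\mathbb Z_5$. The constant $E_{Q_5,\mathbf 1}$ is the least positive integer $k$ such that every sequence in $\mathbb Z_5$ of length $k$ has a $(Q_5,\mathbf 1)$-weighted zero-sum subsequence of length $5$ (terms not necessarily consecutive). -}

module Defs where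

open import Data.Fin.Base using (Fin; toℕ)
open import Data.Fin.Patterns using (0F; 1F; 2F; 3F; 4F)
open import Data.List.Relation.Binary.Sublist.Propositional using (_⊆_)
open import Data.Nat.Base as ℕ using (ℕ; _≤_; _<_; _∸_)
open import Data.Nat.DivMod using (_mod_)
open import Data.Nat.Properties using (≤-antisym)
open import Data.Product.Base using (∃-syntax; _×_; _,_)
open import Data.Sum.Base using (_⊎_; inj₁; inj₂)
open import Data.Vec.Base using (Vec; foldr′; toList; zipWith)
open import Data.Vec.Relation.Unary.All using (All)
open import Function.Bundles using (_⇔_; mk⇔)
open import Relation.Binary.PropositionalEquality using (_≡_; _≢_; refl)
open import Relation.Nullary.Negation using (contradiction)
open import Relation.Unary using (Pred)
open import Level using (0ℓ)

-- Each residue class is represented by its least non-negative member.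

ℤ₅ : Set
ℤ₅ = Fin 5

infixl 6 _+₅_
infixl 7 _*₅_
infix  8 -₅_

_+₅_ : ℤ₅ → ℤ₅ → ℤ₅
x +₅ y = (toℕ x ℕ.+ toℕ y) mod 5

_*₅_ : ℤ₅ → ℤ₅ → ℤ₅
x *₅ y = (toℕ x ℕ.* toℕ y) mod 5

-₅_ : ℤ₅ → ℤ₅
-₅ x = (5 ∸ toℕ x) mod 5

Sequence : ℕ → Set
Sequence k = Vec ℤ₅ k

sum₅ : ∀ {k} → Sequence k → ℤ₅
sum₅ = foldr′ _+₅_ 0F

Q₅ : Pred ℤ₅ 0ℓ
Q₅ a = a ≢ 0F × ∃[ b ] b *₅ b ≡ a

Q₅⇔±1 : ∀ a → Q₅ a ⇔ (a ≡ 1F ⊎ a ≡ -₅ 1F)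
Q₅⇔±1 a = mk⇔ to from
  where
  to : ∀ {a} → Q₅ a → a ≡ 1F ⊎ a ≡ -₅ 1F
  to (a≢0 , 0F , refl) = contradiction refl a≢0
  to (_   , 1F , refl) = inj₁ refl
  to (_   , 2F , refl) = inj₂ refl
  to (_   , 3F , refl) = inj₂ refl
  to (_   , 4F , refl) = inj₁ refl

  from : ∀ {a} → a ≡ 1F ⊎ a ≡ -₅ 1F → Q₅ a
  from (inj₁ refl) = (λ ()) , 1F , refl
  from (inj₂ refl) = (λ ()) , 2F , refl

-- (Q₅,𝟏)-weighted zero-sum sequences: one choice of weights must annihilate
-- both the given sequence and the constant sequence 1.
IsWeightedZeroSum : ∀ {k} → Sequence k → Set
IsWeightedZeroSum {k} xs =
  ∃[ as ] All Q₅ {k} as × sum₅ (zipWith _*₅_ as xs) ≡ 0F × sum₅ as ≡ 0F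

-- _⊆_ is the order-preserving, not necessarily contiguous, sublist relation;
-- distinct terms of ys come from distinct positions of xs.
HasWeightedZeroSumSubsequence : ℕ → ∀ {k} → Sequence k → Set
HasWeightedZeroSumSubsequence l xs =
  ∃[ ys ] toList {n = l} ys ⊆ toList xs × IsWeightedZeroSum ys

IsLeastPositive : Pred ℕ 0ℓ → ℕ → Set
IsLeastPositive P k = 0 < k × P k × (∀ m → 0 < m → P m → k ≤ m)

IsLeastPositive-unique : ∀ {P k l} → IsLeastPositive P k → IsLeastPositive P l → k ≡ l
IsLeastPositive-unique (0<k , Pk , k-min) (0<l , Pl , l-min) =
  ≤-antisym (k-min _ 0<l Pl) (l-min _ 0<k Pk)

-- E[Q₅,𝟏]≡ k says that the constant E_{Q₅,𝟏} exists and equals k;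
-- by IsLeastPositive-unique this holds for at most one k.
E[Q₅,𝟏]≡_ : ℕ → Set
E[Q₅,𝟏]≡ k =
  IsLeastPositive (λ n → (xs : Sequence n) → HasWeightedZeroSumSubsequence 5 xs) k

{-# OPTIONS --safe #-}
-- Five weights ±1 with p signs + sum to 2p - 5, which vanishes mod 5 only for p = 0
-- or p = 5.  The weights are therefore constant, a weighted zero-sum sequence of
-- length 5 is a plain one, and the constant is that of Erdős, Ginzburg and Ziv for ℤ₅.
-- The zero-sum property does not depend on the order of the terms, so for the upper
-- bound only the 715 weakly increasing sequences of length 9 have to be checked; the
-- sequence 0,0,0,0,1,1,1,1 gives the lower bound.
module Submission where

open import Defs

open import Algebra.Structures using (IsCommutativeMonoid)
open import Data.Fin.Base using (Fin; zero)
import Data.Fin.Base as Fin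
open import Data.Fin.Patterns using (0F; 1F)
open import Data.Fin.Properties using (_≟_; _≤?_; all?; any?; ≤-decTotalOrder)
open import Data.List.Base as List using (List; []; _∷_; length)
open import Data.List.Relation.Binary.Permutation.Propositional
  using (_↭_; refl; prep; swap; trans; ↭-refl; ↭-trans; ↭⇒↭ₛ)
open import Data.List.Relation.Binary.Permutation.Propositional.Properties using (↭-length)
import Data.List.Relation.Binary.Permutation.Setoid.Properties as Permutationₛ
open import Data.List.Relation.Binary.Sublist.Propositional
  using (_⊆_; _∷_; _∷ʳ_; ⊆-trans; minimum)
open import Data.List.Relation.Unary.Linked using (Linked; [-]; _∷_)
open import Data.List.Sort (≤-decTotalOrder 5) using (sort; sort-↭; sort-↗)
open import Data.Nat.Base using (ℕ; zero; suc; _≤_; z≤n; s≤s)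
import Data.Nat.Properties as ℕ
open import Data.Product.Base using (∃-syntax; _×_; _,_)
open import Data.Sum.Base using (inj₁; inj₂; [_,_])
open import Data.Vec.Base
  using (Vec; []; _∷_; fromList; map; replicate; toList; truncate; zipWith)
open import Data.Vec.Properties
  using (≡-dec; length-toList; toList∘fromList; zipWith-replicate₁)
open import Data.Vec.Relation.Unary.All as All using (All)
open import Function.Base using (_∘_)
open import Level using (Level)
open import Relation.Binary.PropositionalEquality
  using (_≡_; _≢_; refl; sym; cong; cong₂; setoid; isEquivalence; module ≡-Reasoning)
  renaming (trans to ≡-trans)
open import Relation.Nullary.Decidable
  using (Dec; no; map′; _×-dec_; _⊎-dec_; _→-dec_; ¬?; from-yes; from-no)
open import Relation.Unary using (Pred; Decidable)

private
  variable
    a p : Level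
    A : Set a
    m n : ℕ

all-Vec? : ∀ {k n} {P : Pred (Vec (Fin k) n) p} → Decidable P → Dec (∀ xs → P xs)
all-Vec? {n = zero}  P? = map′ (λ { P[] [] → P[] }) (λ f → f []) (P? [])
all-Vec? {n = suc _} P? =
  map′ (λ { f (x ∷ xs) → f x xs }) (λ f x xs → f (x ∷ xs))
       (all? λ x → all-Vec? (P? ∘ (x ∷_)))

all-increasing? : ∀ {k} n {P : Pred (List (Fin k)) p} → Decidable P → ∀ l →
                  Dec (∀ xs → length xs ≡ n → Linked Fin._≤_ (l ∷ xs) → P xs)
all-increasing? zero    P? l =
  map′ (λ { P[] [] _ _ → P[] }) (λ f → f [] refl [-]) (P? [])
all-increasing? (suc n) P? l =
  map′ (λ { f (x ∷ xs) eq (l≤x ∷ inc) → f x l≤x xs (ℕ.suc-injective eq) inc })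
       (λ f x l≤x xs eq inc → f (x ∷ xs) (cong suc eq) (l≤x ∷ inc))
       -- An entry below `l` makes the implication vacuous, so its whole branch is pruned; this is
       -- what confines the search to weakly increasing lists.
       (all? λ x → (l ≤? x) →-dec all-increasing? n (P? ∘ (x ∷_)) x)

-- A sublist of `x ∷ xs` either takes the head or skips it, and both choices leave a search in `xs`.
any-⊆? : ∀ n {P : Pred (Vec A n) p} → Decidable P → (xs : List A) →
         Dec (∃[ ys ] toList ys ⊆ xs × P ys)
any-⊆? zero    P? xs       =
  map′ (λ P[] → [] , minimum xs , P[]) (λ { ([] , _ , P[]) → P[] }) (P? [])
any-⊆? (suc n) P? []       = no λ { (_ ∷ _ , () , _) }
any-⊆? (suc n) P? (x ∷ xs) =
  map′ [ (λ { (ys , ys⊆ , Pys) → x ∷ ys , refl ∷ ys⊆ , Pys })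
       , (λ { (ys , ys⊆ , Pys) → ys , x ∷ʳ ys⊆ , Pys }) ]
       (λ { (y ∷ ys , refl ∷ ys⊆ , Pys) → inj₁ (ys , ys⊆ , Pys)
          ; (y ∷ ys , _ ∷ʳ ys⊆ , Pys)   → inj₂ (y ∷ ys , ys⊆ , Pys) })
       (any-⊆? n (P? ∘ (x ∷_)) xs ⊎-dec any-⊆? (suc n) P? xs)

-- Induction on the permutation, carrying the chosen positions along. A swap reorders the chosen
-- terms only when it exchanges two of them, so the sublist survives up to permutation.
⊆-resp-↭ : {xs xs′ ys : List A} → xs ↭ xs′ → ys ⊆ xs → ∃[ ys′ ] ys′ ⊆ xs′ × ys′ ↭ ys
⊆-resp-↭ refl ys⊆ = _ , ys⊆ , ↭-refl
⊆-resp-↭ (prep x xs↭) (.x ∷ʳ ys⊆) with ⊆-resp-↭ xs↭ ys⊆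
... | _ , ys′⊆ , ys′↭ = _ , x ∷ʳ ys′⊆ , ys′↭
⊆-resp-↭ (prep x xs↭) (refl ∷ ys⊆) with ⊆-resp-↭ xs↭ ys⊆
... | _ , ys′⊆ , ys′↭ = _ , refl ∷ ys′⊆ , prep x ys′↭
⊆-resp-↭ (swap x y xs↭) (.x ∷ʳ .y ∷ʳ ys⊆) with ⊆-resp-↭ xs↭ ys⊆
... | _ , ys′⊆ , ys′↭ = _ , y ∷ʳ x ∷ʳ ys′⊆ , ys′↭
⊆-resp-↭ (swap x y xs↭) (.x ∷ʳ refl ∷ ys⊆) with ⊆-resp-↭ xs↭ ys⊆
... | _ , ys′⊆ , ys′↭ = _ , refl ∷ x ∷ʳ ys′⊆ , prep y ys′↭
⊆-resp-↭ (swap x y xs↭) (refl ∷ .y ∷ʳ ys⊆) with ⊆-resp-↭ xs↭ ys⊆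
... | _ , ys′⊆ , ys′↭ = _ , y ∷ʳ refl ∷ ys′⊆ , prep x ys′↭
⊆-resp-↭ (swap x y xs↭) (refl ∷ refl ∷ ys⊆) with ⊆-resp-↭ xs↭ ys⊆
... | _ , ys′⊆ , ys′↭ = _ , refl ∷ refl ∷ ys′⊆ , swap y x ys′↭
⊆-resp-↭ (trans xs↭ ↭xs′) ys⊆ with ⊆-resp-↭ xs↭ ys⊆
... | _ , zs⊆ , zs↭ with ⊆-resp-↭ ↭xs′ zs⊆
... | _ , ys′⊆ , ys′↭ = _ , ys′⊆ , ↭-trans ys′↭ zs↭

toList-surjective : (xs : List A) → length xs ≡ n → ∃[ ys ] toList {n = n} ys ≡ xs
toList-surjective xs refl = fromList xs , toList∘fromList xs

truncate-⊆ : (m≤n : m ≤ n) (xs : Vec A n) → toList (truncate m≤n xs) ⊆ toList xs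
truncate-⊆ z≤n       xs       = minimum (toList xs)
truncate-⊆ (s≤s m≤n) (x ∷ xs) = refl ∷ truncate-⊆ m≤n xs

+₅-0-isCommutativeMonoid : IsCommutativeMonoid _≡_ _+₅_ 0F
+₅-0-isCommutativeMonoid = record
  { isMonoid = record
    { isSemigroup = record
      { isMagma = record { isEquivalence = isEquivalence ; ∙-cong = cong₂ _+₅_ }
      ; assoc   = from-yes (all? λ x → all? λ y → all? λ z →
                    (x +₅ y) +₅ z ≟ x +₅ (y +₅ z))
      }
    ; identity = from-yes (all? λ x → 0F +₅ x ≟ x) , from-yes (all? λ x → x +₅ 0F ≟ x)
    }
  ; comm = from-yes (all? λ x → all? λ y → x +₅ y ≟ y +₅ x)
  }

*₅-distribˡ-+₅ : ∀ x y z → x *₅ (y +₅ z) ≡ x *₅ y +₅ x *₅ z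
*₅-distribˡ-+₅ = from-yes (all? λ x → all? λ y → all? λ z →
  x *₅ (y +₅ z) ≟ x *₅ y +₅ x *₅ z)

*₅-zeroʳ : ∀ x → x *₅ 0F ≡ 0F
*₅-zeroʳ = from-yes (all? λ x → x *₅ 0F ≟ 0F)

x*₅y≡0⇒y≡0 : ∀ x y → x ≢ 0F → x *₅ y ≡ 0F → y ≡ 0F
x*₅y≡0⇒y≡0 = from-yes (all? λ x → all? λ y →
  ¬? (x ≟ 0F) →-dec x *₅ y ≟ 0F →-dec y ≟ 0F)

sum₅-map-*₅ : ∀ x (ys : Sequence n) → sum₅ (map (x *₅_) ys) ≡ x *₅ sum₅ ys
sum₅-map-*₅ x []       = sym (*₅-zeroʳ x)
sum₅-map-*₅ x (y ∷ ys) =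
  ≡-trans (cong (x *₅ y +₅_) (sum₅-map-*₅ x ys)) (sym (*₅-distribˡ-+₅ x y (sum₅ ys)))

sum₅-replicate-weighted : ∀ x (ys : Sequence n) →
                          sum₅ (zipWith _*₅_ (replicate n x) ys) ≡ x *₅ sum₅ ys
sum₅-replicate-weighted x ys =
  ≡-trans (cong sum₅ (zipWith-replicate₁ _*₅_ x ys)) (sum₅-map-*₅ x ys)

sum₅-toList : (xs : Sequence n) → sum₅ xs ≡ List.foldr _+₅_ 0F (toList xs)
sum₅-toList []       = refl
sum₅-toList (x ∷ xs) = cong (x +₅_) (sum₅-toList xs)

sum₅-↭ : (xs : Sequence m) (ys : Sequence n) → toList xs ↭ toList ys → sum₅ xs ≡ sum₅ ys
sum₅-↭ xs ys xs↭ys = begin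
  sum₅ xs                         ≡⟨ sum₅-toList xs ⟩
  List.foldr _+₅_ 0F (toList xs)  ≡⟨ foldr-commMonoid +₅-0-isCommutativeMonoid (↭⇒↭ₛ xs↭ys) ⟩
  List.foldr _+₅_ 0F (toList ys)  ≡⟨ sum₅-toList ys ⟨
  sum₅ ys                         ∎
  where
  open ≡-Reasoning
  open Permutationₛ (setoid ℤ₅) using (foldr-commMonoid)

-- The Erdős-Ginzburg-Ziv property, without weights. The ambient sequence is a list so that sorting
-- and permutations apply directly.
HasZeroSum : ℕ → List ℤ₅ → Set
HasZeroSum n xs = ∃[ ys ] toList {n = n} ys ⊆ xs × sum₅ ys ≡ 0F

hasZeroSum? : ∀ n → Decidable (HasZeroSum n)
hasZeroSum? n = any-⊆? n (λ ys → sum₅ ys ≟ 0F)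

HasZeroSum-resp-↭ : ∀ {xs xs′} → xs ↭ xs′ → HasZeroSum n xs → HasZeroSum n xs′
HasZeroSum-resp-↭ xs↭xs′ (ys , ys⊆xs , sum≡0) with ⊆-resp-↭ xs↭xs′ ys⊆xs
... | zs , zs⊆xs′ , zs↭ys
  -- The permuted sublist `zs` is a bare list; sharing its length with `ys` makes it a vector of
  -- length `n` again.
  with toList-surjective zs (≡-trans (↭-length zs↭ys) (length-toList ys))
... | ys′ , refl = ys′ , zs⊆xs′ , ≡-trans (sum₅-↭ ys′ ys zs↭ys) sum≡0

-- Transparent, the exhaustive searches would be unfolded by later with-abstractions.
abstract
  increasing⇒HasZeroSum : ∀ xs → length xs ≡ 9 → Linked Fin._≤_ (0F ∷ xs) → HasZeroSum 5 xs
  increasing⇒HasZeroSum = from-yes (all-increasing? 9 (hasZeroSum? 5) 0F)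

length≡9⇒HasZeroSum : ∀ xs → length xs ≡ 9 → HasZeroSum 5 xs
length≡9⇒HasZeroSum xs eq = HasZeroSum-resp-↭ (sort-↭ xs)
  (increasing⇒HasZeroSum (sort xs) (≡-trans (↭-length (sort-↭ xs)) eq) (0∷ sort-↗ xs))
  where
  -- `0F` is the least element, so starting the search from this bound excludes no sorted list.
  0∷_ : ∀ {xs} → Linked Fin._≤_ xs → Linked Fin._≤_ (zero {n = 4} ∷ xs)
  0∷_ {[]}    _   = [-]
  0∷_ {_ ∷ _} inc = z≤n ∷ inc

Q₅? : Decidable Q₅
Q₅? a = ¬? (a ≟ 0F) ×-dec any? (λ b → b *₅ b ≟ a)

abstract
  -- All 3125 vectors are checked. Of the common weight only its being non-zero is recorded, which
  -- suffices for cancelling it.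
  weights-constant : (as : Sequence 5) → All Q₅ as → sum₅ as ≡ 0F →
                     ∃[ c ] c ≢ 0F × as ≡ replicate 5 c
  weights-constant = from-yes (all-Vec? λ as →
    All.all? Q₅? as →-dec sum₅ as ≟ 0F →-dec
    any? (λ c → ¬? (c ≟ 0F) ×-dec ≡-dec _≟_ as (replicate 5 c)))

weightedZeroSum⇒sum≡0 : (ys : Sequence 5) → IsWeightedZeroSum ys → sum₅ ys ≡ 0F
weightedZeroSum⇒sum≡0 ys (as , Qas , weighted≡0 , as≡0) with weights-constant as Qas as≡0
... | c , c≢0 , refl =
  x*₅y≡0⇒y≡0 c (sum₅ ys) c≢0 (≡-trans (sym (sum₅-replicate-weighted c ys)) weighted≡0)

sum≡0⇒weightedZeroSum : (ys : Sequence 5) → sum₅ ys ≡ 0F → IsWeightedZeroSum ys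
sum≡0⇒weightedZeroSum ys sum≡0 =
  -- With every weight 1 the weights sum to 5, which is 0 by computation.
  replicate 5 1F ,
  from-yes (All.all? Q₅? (replicate 5 1F)) ,
  ≡-trans (sum₅-replicate-weighted 1F ys) (cong (1F *₅_) sum≡0) ,
  refl

-- Each value occurs only four times, so any five terms include between one and four ones, and their
-- sum is not 0 mod 5.
extremal : Sequence 8
extremal = 0F ∷ 0F ∷ 0F ∷ 0F ∷ 1F ∷ 1F ∷ 1F ∷ 1F ∷ []

corollary2p4 : E[Q₅,𝟏]≡ 9
corollary2p4 = s≤s z≤n , upper , λ m _ → lower m
  where
  upper : (xs : Sequence 9) → HasWeightedZeroSumSubsequence 5 xs
  upper xs = let ys , ys⊆xs , sum≡0 = length≡9⇒HasZeroSum (toList xs) (length-toList xs) in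
    ys , ys⊆xs , sum≡0⇒weightedZeroSum ys sum≡0

  lower : ∀ m → ((xs : Sequence m) → HasWeightedZeroSumSubsequence 5 xs) → 9 ≤ m
  -- If `m ≤ 8`, the first `m` terms of `extremal` would contain a zero-sum subsequence of length 5,
  -- and hence so would `extremal`. The negation of `m ≤ 8` is `8 < m`, that is `9 ≤ m`.
  lower m has = ℕ.≰⇒> λ m≤8 → let ys , ys⊆ , wzs = has (truncate m≤8 extremal) in
    from-no (hasZeroSum? 5 (toList extremal))
      (ys , ⊆-trans ys⊆ (truncate-⊆ m≤8 extremal) , weightedZeroSum⇒sum≡0 ys wzs)
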